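{- Let $\ell\ge3$. A partition $\lambda$ belongs to the crystal $B(\Lambda_0)^L$ if and only if there does not exist a box $(i,j)\in\lambda$ such that $h^\lambda_{(i,j)}=\ell\cdot\mathrm{arm}(i,j)$.
   Context: For a box $(i,j)$ (row $i$, column $j$) of $\lambda$, $\mathrm{arm}(i,j)$ is the number of boxes of $\lambda$ strictly to its right in row $i$, $\mathrm{leg}(i,j)$ the number of boxes strictly below it in column $j$, and the hook length is $h^\lambda_{(i,j)}=\mathrm{arm}(i,j)+\mathrm{leg}(i,j)+1$. Ladder crystal. The position $(a,b)$ (row $a$, column $b$) has residue $b-a\bmod\ell$. The ladder of $(a,b)$ is the set of positions $(c,d)$, $c,d\ge1$, with $c-a=(\ell-1)(b-d)$; all its positions have the same residue, and it is an $i$-ladder if that residue is $i$. Ladders are ordered left to right, i.e. by increasing value of $a+(\ell-1)(b-1)$. A box of $\lambda$ of residue $i$ whose removal leaves a partition is a removable $i$-box; a position of residue $i$ not in $\lambda$ whose addition gives a partition is an addable $i$-box. Given a partition $\lambda$ and $0\le i<\ell$, label each addable $i$-box $+$ and each removable $i$-box $-$; the ladder $i$-signature is the word read from leftmost $i$-ladder to rightmost $i$-ladder, and from top to bottom on each ladder. Repeatedly cancel adjacent pairs $-+$ to get a word $+\cdots+-\cdots-$. $\widehat f_i\lambda$ is $\lambda$ together with the box of the rightmost remaining $+$ (or $0$ if there is none). The nodes of $B(\Lambda_0)^L$ are the partitions obtained from the empty partition $\emptyset$ by applying finite sequences of the operators $\widehat f_i$, $0\le i<\ell$. -}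

module Defs where

open import Data.Nat.Base using (ℕ; zero; suc; _+_; _*_; _∸_; _<_; _≥_; NonZero)
open import Data.Nat.Properties using (_<?_)
open import Data.Integer.Base as ℤ using (+_; 1ℤ)
open import Data.Integer.DivMod using (_%ℕ_)
open import Data.Fin.Base using (Fin; toℕ)
open import Data.Sign.Base using (Sign)
open import Data.List.Base using (List; []; _∷_; _++_; length; filter; drop)
open import Data.List.Membership.Propositional using (_∈_)
open import Data.List.Relation.Unary.All using (All; [])
open import Data.List.Relation.Unary.AllPairs using (AllPairs)
open import Data.List.Relation.Unary.Linked using (Linked; [])
open import Data.Product.Base using (_×_; _,_; proj₁; proj₂; ∃-syntax)
open import Data.Sum.Base using (_⊎_)
open import Function.Bundles using (_⇔_)
open import Relation.Binary.Construct.Closure.ReflexiveTransitive using (Star)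
open import Relation.Binary.PropositionalEquality.Core using (_≡_; _≢_)
open import Relation.Nullary.Negation.Core using (¬_)

record Partition : Set where
  field
    parts      : List ℕ
    decreasing : Linked _≥_ parts
    positive   : All (0 <_) parts

open Partition public

∅ : Partition
∅ = record { parts = [] ; decreasing = [] ; positive = [] }

-- (row , column), both counted from 0.  Counting from 0 instead of 1 does not
-- change column - row, and lowers every ladder value (below) by exactly 1.
Position : Set
Position = ℕ × ℕ

-- 0 for rows below the last one.
rowLength : List ℕ → ℕ → ℕ
rowLength []       _       = 0
rowLength (x ∷ _)  zero    = x
rowLength (_ ∷ xs) (suc r) = rowLength xs r

infix 4 _∈ᵇ_ _∉ᵇ_

_∈ᵇ_ : Position → Partition → Set
(r , c) ∈ᵇ μ = c < rowLength (parts μ) r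

_∉ᵇ_ : Position → Partition → Set
p ∉ᵇ μ = ¬ (p ∈ᵇ μ)

-- Row r has boxes in columns 0 , … , rowLength (parts μ) r - 1.
arm : Partition → Position → ℕ
arm μ (r , c) = rowLength (parts μ) r ∸ suc c

-- Each row strictly below r contributes a box to column c iff it is longer than c.
leg : Partition → Position → ℕ
leg μ (r , c) = length (filter (c <?_) (drop (suc r) (parts μ)))

hook : Partition → Position → ℕ
hook μ p = arm μ p + leg μ p + 1

-- AddBox μ p ν : p is not in μ, and ν = μ ∪ {p}.
AddBox : Partition → Position → Partition → Set
AddBox μ p ν = p ∉ᵇ μ × (∀ q → q ∈ᵇ ν ⇔ (q ∈ᵇ μ ⊎ q ≡ p))

-- RemoveBox μ p ν : p is in μ, and ν = μ ∖ {p}.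
RemoveBox : Partition → Position → Partition → Set
RemoveBox μ p ν = p ∈ᵇ μ × (∀ q → q ∈ᵇ ν ⇔ (q ∈ᵇ μ × q ≢ p))

Addable : Partition → Position → Set
Addable μ p = ∃[ ν ] AddBox μ p ν

Removable : Partition → Position → Set
Removable μ p = ∃[ ν ] RemoveBox μ p ν

-- A word in the signs, each remembering the position it labels.
Word : Set
Word = List (Sign × Position)

infix 4 _⇝_

data _⇝_ : Word → Word → Set where
  cancel : ∀ u p q v →
           (u ++ (Sign.- , p) ∷ (Sign.+ , q) ∷ v) ⇝ (u ++ v)

module LadderCrystal (ℓ : ℕ) .{{_ : NonZero ℓ}} where

  residue : Position → ℕ
  residue (r , c) = (+ c ℤ.- + r) %ℕ ℓ

  SameLadder : Position → Position → Set
  SameLadder (a , b) (c , d) =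
    + c ℤ.- + a ≡ (+ ℓ ℤ.- 1ℤ) ℤ.* (+ b ℤ.- + d)

  -- Constant on each ladder; ladders are ordered left to right by this value.
  ladderValue : Position → ℕ
  ladderValue (r , c) = r + (ℓ ∸ 1) * c

  -- Reading order: ladders left to right, each ladder top to bottom.
  ReadBefore : Position → Position → Set
  ReadBefore p q =
    ladderValue p < ladderValue q ⊎ (SameLadder p q × proj₁ p < proj₁ q)

  HasLabel : Fin ℓ → Partition → Sign → Position → Set
  HasLabel i μ Sign.+ p = Addable μ p × residue p ≡ toℕ i
  HasLabel i μ Sign.- p = Removable μ p × residue p ≡ toℕ i

  -- ReadBefore is a strict order, so these two conditions determine the word.
  record IsSignature (i : Fin ℓ) (μ : Partition) (w : Word) : Set where
    field
      sorted   : AllPairs (λ x y → ReadBefore (proj₂ x) (proj₂ y)) w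
      complete : ∀ s p → (s , p) ∈ w ⇔ HasLabel i μ s p

  -- The graph of f̂ᵢ: F̂ i μ ν means f̂ᵢ μ = ν.  When f̂ᵢ μ = 0, i.e. no + survives
  -- cancellation, there is no such ν.  The fully cancelled word is
  -- pluses ++ (+ , box) ∷ minuses, so box carries its rightmost +.
  record F̂ (i : Fin ℓ) (μ ν : Partition) : Set where
    field
      signature   : Word
      isSignature : IsSignature i μ signature
      pluses      : Word
      box         : Position
      minuses     : Word
      allPlus     : All (λ x → proj₁ x ≡ Sign.+) pluses
      allMinus    : All (λ x → proj₁ x ≡ Sign.-) minuses
      cancels     : Star _⇝_ signature (pluses ++ (Sign.+ , box) ∷ minuses)
      addsBox     : AddBox μ box ν

  -- The nodes of B(Λ₀)^L.
  data InCrystal : Partition → Set where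
    empty : InCrystal ∅
    apply : ∀ {i μ ν} → InCrystal μ → F̂ i μ ν → InCrystal ν

module Submission where

-- Put k = ℓ - 1.  In terms of row and column lengths, a bad hook (one with h = ℓ · arm) is an
-- equation col c = r + k * a, where a is the arm of (r , c).  Hence a removable box and an
-- addable position on its ladder below it, or on the next ladder of its residue above it, span
-- a bad hook.  Adding a box x to μ can create a bad hook only if some addable position of the
-- residue of x is read after x, on the ladder of x or on the next one.  If x carries the
-- rightmost surviving +, that position is cancelled by a removable box read in between, and
-- these two span a bad hook of μ.  Removing the box of the leftmost surviving − is dual.
-- Finally, without bad hooks a removable box of maximal ladder value has no later + of its
-- residue, since near any such + there is a removable box of larger ladder value; so some −
-- survives, and one can descend to ∅.

open import Defs
open import Data.Fin.Base using (Fin; toℕ; fromℕ<)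
open import Data.Fin.Properties using (toℕ-fromℕ<)
open import Data.Integer.Base as ℤ using (1ℤ) renaming (+_ to pos)
open import Data.Integer.DivMod using (_/ℕ_; n%ℕd<d; a≡a%ℕn+[a/ℕn]*n)
import Data.Integer.Divisibility.Signed as ℤ
import Data.Integer.Properties as ℤ
import Data.Integer.Tactic.RingSolver as ℤ
open import Data.List.Base using (List; []; _∷_; _++_; length; filter; drop; upTo; cartesianProduct)
open import Data.List.Membership.Propositional using (_∈_; lose; find)
open import Data.List.Membership.Propositional.Properties
  using (∈-++⁺ˡ; ∈-++⁺ʳ; ∈-++⁻; ∈-cartesianProduct⁺; ∈-upTo⁺)
open import Data.List.Properties using (filter-accept; filter-reject; map-++; ++-identityʳ)
open import Data.List.Relation.Unary.All as All using (All; []; _∷_)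
import Data.List.Relation.Unary.All.Properties as All
open import Data.List.Relation.Unary.AllPairs as AllPairs using (AllPairs; []; _∷_)
import Data.List.Relation.Unary.AllPairs.Properties as AllPairs
open import Data.List.Relation.Unary.Any using (here; there; any?)
open import Data.List.Relation.Unary.Linked as Linked using (Linked; []; [-]; _∷_)
open import Data.Nat.Base
open import Data.Nat.Divisibility using (_∣_; ∣⇒≤; ∣m+n∣m⇒∣n; ∣-refl; _∣0)
open import Data.Nat.ListAction using (sum)
open import Data.Nat.Properties
open import Data.Nat.Tactic.RingSolver using (solve-∀)
open import Data.Product.Base using (_×_; _,_; proj₁; proj₂; map₁; ∃-syntax)
open import Data.Product.Properties using (≡-dec)
open import Data.Sign.Base using (Sign)
open import Data.Sign.Properties using () renaming (_≟_ to _≟ₛ_)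
open import Data.Sum.Base as Sum using (_⊎_; inj₁; inj₂; [_,_]′)
open import Function.Base using (_∘_; id; _on_)
open import Function.Bundles using (_⇔_; mk⇔; Equivalence)
import Function.Properties.Equivalence as Equivalence′
open import Relation.Binary.Construct.Closure.ReflexiveTransitive using (Star; ε; _◅_; _◅◅_)
open import Relation.Binary.Definitions using (tri<; tri≈; tri>)
open import Relation.Binary.PropositionalEquality
  using (_≡_; _≢_; refl; sym; trans; cong; cong₂; subst; subst₂; module ≡-Reasoning)
open import Relation.Nullary using (¬_; Dec; yes; no; contradiction)
open import Relation.Nullary.Decidable using (_×-dec_)

open Equivalence using (to; from)

-- Row and column lengths

colLength : List ℕ → ℕ → ℕ
colLength xs c = length (filter (c <?_) xs)

row col : Partition → ℕ → ℕ
row μ = rowLength (parts μ)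
col μ = colLength (parts μ)

rowLength≤head : ∀ {x xs} → Linked _≥_ (x ∷ xs) → ∀ r → rowLength xs r ≤ x
rowLength≤head [-]       r       = z≤n
rowLength≤head (x≥y ∷ l) zero    = x≥y
rowLength≤head (x≥y ∷ l) (suc r) = ≤-trans (rowLength≤head l r) x≥y

rowLength-bounded : ∀ {x xs} → Linked _≥_ (x ∷ xs) → ∀ r → rowLength (x ∷ xs) r ≤ x
rowLength-bounded l zero    = ≤-refl
rowLength-bounded l (suc r) = rowLength≤head l r

-- The parts decrease, so the rows longer than `c` form an initial segment and counting them gives
-- the height of column `c`. Once a head fails `c < x`, every later row fails too, and both sides
-- are absurd.
<rowLength⇔<colLength : ∀ {xs} → Linked _≥_ xs → ∀ r c →
  c < rowLength xs r ⇔ r < colLength xs c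
<rowLength⇔<colLength {[]}     l r c = mk⇔ (λ ()) (λ ())
<rowLength⇔<colLength {x ∷ xs} l r c with c <? x
... | no c≮x rewrite filter-reject (c <?_) {xs = xs} c≮x = mk⇔
  (λ c<r → contradiction (<-≤-trans c<r (rowLength-bounded l r)) c≮x)
  (λ r<c → contradiction
    (<-≤-trans (from (<rowLength⇔<colLength (Linked.tail l) r c) r<c) (rowLength≤head l r)) c≮x)
<rowLength⇔<colLength {x ∷ xs} l zero    c | yes c<x
  rewrite filter-accept (c <?_) {xs = xs} c<x = mk⇔ (λ _ → z<s) (λ _ → c<x)
<rowLength⇔<colLength {x ∷ xs} l (suc r) c | yes c<x
  rewrite filter-accept (c <?_) {xs = xs} c<x = mk⇔
  (s<s ∘ to (<rowLength⇔<colLength (Linked.tail l) r c))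
  (from (<rowLength⇔<colLength (Linked.tail l) r c) ∘ s<s⁻¹)

colLength-drop : ∀ {xs} → Linked _≥_ xs → ∀ n c →
  colLength (drop n xs) c ≡ colLength xs c ∸ n
colLength-drop l zero c = refl
colLength-drop {[]} l (suc n) c = refl
colLength-drop {x ∷ xs} l (suc n) c with c <? x
... | yes c<x rewrite filter-accept (c <?_) {xs = xs} c<x = colLength-drop (Linked.tail l) n c
... | no c≮x rewrite filter-reject (c <?_) {xs = xs} c≮x = begin
  colLength (drop n xs) c  ≡⟨ colLength-drop (Linked.tail l) n c ⟩
  colLength xs c ∸ n       ≡⟨ cong (_∸ n) empty ⟩
  0 ∸ n                    ≡⟨ 0∸n≡0 n ⟩
  0                        ≡⟨ cong (_∸ suc n) empty ⟨
  colLength xs c ∸ suc n   ∎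
  where
  open ≡-Reasoning
  empty : colLength xs c ≡ 0
  empty = n≤0⇒n≡0 (≮⇒≥ λ 0<col → c≮x
    (<-≤-trans (from (<rowLength⇔<colLength (Linked.tail l) 0 c) 0<col) (rowLength≤head l 0)))

leg≡ : ∀ μ r c → leg μ (r , c) ≡ col μ c ∸ suc r
leg≡ μ r c = colLength-drop (decreasing μ) (suc r) c

-- Symmetric in rows and columns, so that each consequence serves for both, through `row-col` and
-- `col-row`.
Conjugate : (f g : ℕ → ℕ) → Set
Conjugate f g = ∀ r c → c < f r ⇔ r < g c

row-col : ∀ μ → Conjugate (row μ) (col μ)
row-col μ = <rowLength⇔<colLength (decreasing μ)

conjugate-sym : ∀ {f g} → Conjugate f g → Conjugate g f
conjugate-sym conj c r = Equivalence′.sym (conj r c)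

col-row : ∀ μ → Conjugate (col μ) (row μ)
col-row μ = conjugate-sym (row-col μ)

conjugate-antitone : ∀ {f g} → Conjugate f g → ∀ {a b} → a ≤ b → f b ≤ f a
conjugate-antitone {f} conj {a} {b} a≤b = ≮⇒≥ λ fa<fb →
  <-irrefl refl (from (conj a (f a)) (≤-<-trans a≤b (to (conj b (f a)) fa<fb)))

module _ {f g : ℕ → ℕ} (conj : Conjugate f g) where

  conjugate-≤ : ∀ {r c} → g c ≤ r → f r ≤ c
  conjugate-≤ g≤r = ≮⇒≥ λ c<f → <⇒≱ (to (conj _ _) c<f) g≤r

  -- For `f = row` and `g = col`: the position just below column `c` is addable unless the column to
  -- its left is equally long. In the latter case a hook can be moved one column to the left with
  -- the same foot row.
  outer-or-repeated : ∀ c → f (g c) ≡ c ⊎ (∃[ b ] c ≡ suc b × g b ≡ g c)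
  outer-or-repeated c with m≤n⇒m<n∨m≡n (conjugate-≤ (≤-refl {g c}))
  ... | inj₂ eq = inj₁ eq
  outer-or-repeated (suc b) | inj₁ (s≤s f≤b) = inj₂ (b , refl , ≤-antisym
    (≮⇒≥ λ g<g → <⇒≱ (from (conj _ _) g<g) f≤b)
    (conjugate-antitone (conjugate-sym conj) (n≤1+n b)))

  -- The inner counterpart: the foot of column `c` is removable unless the column to its right is
  -- equally long.
  inner-or-repeated : ∀ c {m} → g c ≡ suc m → f m ≡ suc c ⊎ g (suc c) ≡ g c
  inner-or-repeated c {m} eq
    with m≤n⇒m<n∨m≡n (from (conj m c) (≤-reflexive (sym eq)))
  ... | inj₂ e = inj₁ (sym e)
  ... | inj₁ sc<f = inj₂ (≤-antisym
    (conjugate-antitone (conjugate-sym conj) (n≤1+n c))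
    (subst (_≤ g (suc c)) (sym eq) (to (conj m (suc c)) sc<f)))

-- Corners

OuterCorner InnerCorner : Partition → Position → Set
OuterCorner μ (r , c) = row μ r ≡ c × col μ c ≡ r
InnerCorner μ (r , c) = row μ r ≡ suc c × col μ c ≡ suc r

≡-from-< : ∀ {a b} → (∀ j → j < a ⇔ j < b) → a ≡ b
≡-from-< same = ≤-antisym
  (≮⇒≥ λ b<a → <-irrefl refl (to (same _) b<a))
  (≮⇒≥ λ a<b → <-irrefl refl (from (same _) a<b))

-- Applied to the row and the column through an added box. If `a < x`, then `a` would lie in the
-- larger initial segment without being old or equal to `x`; hence the box sits at the end of both.
extended : ∀ {a b x} → ¬ x < a → (∀ j → j < b ⇔ (j < a ⊎ j ≡ x)) → a ≡ x × b ≡ suc x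
extended {a} {b} {x} x≮a ext = a≡x , ≤-antisym
  (≮⇒≥ λ sx<b → [ (λ sx<a → x≮a (<-trans (n<1+n x) sx<a)) , 1+n≢n ]′ (to (ext _) sx<b))
  x<b
  where
  x<b : x < b
  x<b = from (ext x) (inj₂ refl)
  a≡x : a ≡ x
  a≡x with m≤n⇒m<n∨m≡n (≮⇒≥ x≮a)
  ... | inj₂ eq  = eq
  ... | inj₁ a<x = [ (λ a<a → contradiction a<a (<-irrefl refl)) , id ]′
                     (to (ext a) (<-trans a<x x<b))

module _ μ ν {r c} (add : AddBox μ (r , c) ν) where

  private
    in-col : ∀ r' → r' < col ν c ⇔ (r' < col μ c ⊎ r' ≡ r)
    in-col r' = mk⇔
      (λ lt → Sum.map (to (row-col μ _ _)) (cong proj₁) (to (proj₂ add (r' , c)) (from (row-col ν _ _) lt)))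
      (λ s → to (row-col ν _ _)
        (from (proj₂ add (r' , c)) (Sum.map (from (row-col μ _ _)) (cong (_, c)) s)))

    in-row : ∀ c' → c' < row ν r ⇔ (c' < row μ r ⊎ c' ≡ c)
    in-row c' = mk⇔
      (λ lt → Sum.map₂ (cong proj₂) (to (proj₂ add (r , c')) lt))
      (λ s → from (proj₂ add (r , c')) (Sum.map₂ (cong (r ,_)) s))

    row-extended = extended (proj₁ add) in-row
    col-extended = extended (proj₁ add ∘ from (row-col μ r c)) in-col

  add-outer : OuterCorner μ (r , c)
  add-outer = proj₁ row-extended , proj₁ col-extended

  add-inner : InnerCorner ν (r , c)
  add-inner = proj₂ row-extended , proj₂ col-extended

  add-row : ∀ {r'} → r' ≢ r → row ν r' ≡ row μ r'
  add-row {r'} r'≢r = ≡-from-< λ c' → mk⇔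
    (λ lt → [ id , (λ eq → contradiction (cong proj₁ eq) r'≢r) ]′ (to (proj₂ add (r' , c')) lt))
    (λ lt → from (proj₂ add (r' , c')) (inj₁ lt))

  add-col : ∀ {c'} → c' ≢ c → col ν c' ≡ col μ c'
  add-col {c'} c'≢c = ≡-from-< λ r' → mk⇔
    (λ lt → [ to (row-col μ r' c') , (λ eq → contradiction (cong proj₂ eq) c'≢c) ]′
              (to (proj₂ add (r' , c')) (from (row-col ν r' c') lt)))
    (λ lt → to (row-col ν r' c') (from (proj₂ add (r' , c')) (inj₁ (from (row-col μ r' c') lt))))

_≟ₚ_ : (p q : Position) → Dec (p ≡ q)
_≟ₚ_ = ≡-dec _≟_ _≟_

remove⇒add : ∀ μ {p} ν → RemoveBox ν p μ → AddBox μ p ν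
remove⇒add μ {p} ν (p∈ν , rem) = (λ p∈μ → proj₂ (to (rem p) p∈μ) refl) , λ q → mk⇔
  (q∈ν⇒ q)
  [ proj₁ ∘ to (rem q) , (λ { refl → p∈ν }) ]′
  where
  q∈ν⇒ : ∀ q → q ∈ᵇ ν → q ∈ᵇ μ ⊎ q ≡ p
  q∈ν⇒ q q∈ν with q ≟ₚ p
  ... | yes q≡p = inj₂ q≡p
  ... | no q≢p  = inj₁ (from (rem q) (q∈ν , q≢p))

add⇒remove : ∀ μ {p} ν → AddBox μ p ν → RemoveBox ν p μ
add⇒remove μ {p} ν (p∉μ , add) = from (add p) (inj₂ refl) , λ q → mk⇔
  (λ q∈μ → from (add q) (inj₁ q∈μ) , λ { refl → p∉μ q∈μ })
  (λ (q∈ν , q≢p) → [ id , (λ q≡p → contradiction q≡p q≢p) ]′ (to (add q) q∈ν))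

-- Partitions with prescribed row lengths

linked-∷ : ∀ {x xs} → rowLength xs 0 ≤ x → Linked _≥_ xs → Linked _≥_ (x ∷ xs)
linked-∷ {xs = []}    _   _ = [-]
linked-∷ {xs = _ ∷ _} y≤x l = y≤x ∷ l

-- The list stops at the first zero value, which keeps all parts positive; antitonicity makes the
-- later values zero as well. `N` bounds the recursion.
fromRows : ∀ N (f : ℕ → ℕ) → (∀ n → f (suc n) ≤ f n) → f N ≡ 0 →
  ∃[ μ ] ∀ r → row μ r ≡ f r
fromRows N f anti fN≡0 with f 0 in eq
... | zero = ∅ , λ r → sym (vanishes r)
  where
  vanishes : ∀ r → f r ≡ 0
  vanishes zero    = eq
  vanishes (suc r) = n≤0⇒n≡0 (subst (f (suc r) ≤_) (vanishes r) (anti r))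
fromRows zero f anti fN≡0 | suc x = contradiction (trans (sym eq) fN≡0) λ ()
fromRows (suc N) f anti fN≡0 | suc x = record
  { parts      = suc x ∷ parts μ
  ; decreasing = linked-∷ (subst₂ _≤_ (sym (rows 0)) eq (anti 0)) (decreasing μ)
  ; positive   = z<s ∷ positive μ
  } , λ { zero → sym eq ; (suc r) → rows r }
  where
  rest = fromRows N (f ∘ suc) (anti ∘ suc) fN≡0
  μ    = proj₁ rest
  rows = proj₂ rest

replace : ℕ → ℕ → (ℕ → ℕ) → ℕ → ℕ
replace r v f j with j ≟ r
... | yes _ = v
... | no _  = f j

replace-at : ∀ r v f → replace r v f r ≡ v
replace-at r v f with r ≟ r
... | yes _  = refl
... | no r≢r = contradiction refl r≢r

replace-off : ∀ {r v f j} → j ≢ r → replace r v f j ≡ f j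
replace-off {r} {j = j} j≢r with j ≟ r
... | yes j≡r = contradiction j≡r j≢r
... | no _    = refl

replace-rows : ∀ μ r v → row μ (suc r) ≤ v → (∀ a → suc a ≡ r → v ≤ row μ a) →
  ∃[ ν ] ∀ j → row ν j ≡ replace r v (row μ) j
replace-rows μ r v below above = fromRows N (replace r v (row μ)) antitone
  (trans (replace-off N≢r) (n≤0⇒n≡0 (conjugate-≤ (row-col μ) (m≤n+m (col μ 0) (suc r)))))
  where
  -- `row μ` vanishes from `col μ 0` on, and the summand `suc r` keeps `N` beyond the altered row.
  N : ℕ
  N = suc r + col μ 0

  N≢r : N ≢ r
  N≢r = m+1+n≢m r ∘ trans (+-suc r (col μ 0))

  antitone : ∀ n → replace r v (row μ) (suc n) ≤ replace r v (row μ) n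
  antitone n with suc n ≟ r | n ≟ r
  ... | yes refl | yes ()
  ... | yes eq   | no _     = above n eq
  ... | no _     | yes refl = below
  ... | no _     | no _     = conjugate-antitone (row-col μ) (n≤1+n n)

rows⇒add : ∀ μ ν {r c} → row μ r ≡ c → row ν r ≡ suc c →
  (∀ {j} → j ≢ r → row ν j ≡ row μ j) → AddBox μ (r , c) ν
rows⇒add μ ν {r} {c} μr νr same =
  (λ c<row → <-irrefl (sym μr) c<row) , λ q → mk⇔ (added q) (kept q)
  where
  added : ∀ q → q ∈ᵇ ν → q ∈ᵇ μ ⊎ q ≡ (r , c)
  added (j , d) d<row with j ≟ r
  ... | no j≢r   = inj₁ (subst (d <_) (same j≢r) d<row)
  ... | yes refl with m≤n⇒m<n∨m≡n (s≤s⁻¹ (subst (d <_) νr d<row))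
  ...   | inj₁ d<c  = inj₁ (subst (d <_) (sym μr) d<c)
  ...   | inj₂ refl = inj₂ refl

  kept : ∀ q → q ∈ᵇ μ ⊎ q ≡ (r , c) → q ∈ᵇ ν
  kept _       (inj₂ refl) = subst (c <_) (sym νr) (n<1+n c)
  kept (j , d) (inj₁ d<row) with j ≟ r
  ... | no j≢r   = subst (d <_) (sym (same j≢r)) d<row
  ... | yes refl = subst (d <_) (sym νr) (m<n⇒m<1+n (subst (d <_) μr d<row))

-- Trades an existential over partitions for two decidable equations. The row above is long enough
-- to allow the new box because column `c` has height `r`.
addable⇔outer : ∀ μ {p} → Addable μ p ⇔ OuterCorner μ p
addable⇔outer μ {r , c} = mk⇔ (λ (ν , add) → add-outer μ ν add) λ (row≡ , col≡) →
  let ν , rows = replace-rows μ r (suc c)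
        (m≤n⇒m≤1+n (≤-trans (conjugate-antitone (row-col μ) (n≤1+n r)) (≤-reflexive row≡)))
        (λ { a refl → from (row-col μ a c) (≤-reflexive (sym col≡)) })
  in ν , rows⇒add μ ν row≡ (trans (rows r) (replace-at r _ _))
           (λ j≢r → trans (rows _) (replace-off j≢r))

removable⇔inner : ∀ ν {p} → Removable ν p ⇔ InnerCorner ν p
removable⇔inner ν {r , c} = mk⇔ (λ (μ , rem) → add-inner μ ν (remove⇒add μ ν rem)) λ (row≡ , col≡) →
  let μ , rows = replace-rows ν r c
        (conjugate-≤ (row-col ν) (≤-reflexive col≡))
        (λ { a refl → ≤-trans (n≤1+n c) (from (row-col ν a c)
               (subst (a <_) (sym col≡) (m<n⇒m<1+n (n<1+n a)))) })
  in μ , add⇒remove μ ν (rows⇒add μ ν (trans (rows r) (replace-at r _ _)) row≡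
           (λ j≢r → sym (trans (rows _) (replace-off j≢r))))

-- Size, and corners beyond a given box

sum-mono : ∀ xs ys → (∀ r → rowLength xs r ≤ rowLength ys r) → sum xs ≤ sum ys
sum-mono []       ys       le = z≤n
sum-mono (x ∷ xs) []       le = +-mono-≤ (le 0) (sum-mono xs [] (le ∘ suc))
sum-mono (x ∷ xs) (y ∷ ys) le = +-mono-≤ (le 0) (sum-mono xs ys (le ∘ suc))

sum-strict : ∀ xs ys → (∀ r → rowLength xs r ≤ rowLength ys r) →
  ∀ r → rowLength xs r < rowLength ys r → sum xs < sum ys
sum-strict []       (y ∷ ys) le zero    lt = <-≤-trans lt (m≤m+n y (sum ys))
sum-strict []       (y ∷ ys) le (suc r) lt =
  <-≤-trans (sum-strict [] ys (λ _ → z≤n) r lt) (m≤n+m (sum ys) y)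
sum-strict (x ∷ xs) (y ∷ ys) le zero    lt = +-mono-<-≤ lt (sum-mono xs ys (le ∘ suc))
sum-strict (x ∷ xs) (y ∷ ys) le (suc r) lt = +-mono-≤-< (le 0) (sum-strict xs ys (le ∘ suc) r lt)

size : Partition → ℕ
size μ = sum (parts μ)

add-size : ∀ μ ν {r c} → AddBox μ (r , c) ν → size μ < size ν
add-size μ ν {r} {c} add = sum-strict (parts μ) (parts ν) grows r
  (subst₂ _<_ (sym (proj₁ (add-outer μ ν add))) (sym (proj₁ (add-inner μ ν add))) (n<1+n c))
  where
  grows : ∀ j → row μ j ≤ row ν j
  grows j = ≮⇒≥ λ lt → <-irrefl refl (from (proj₂ add (j , row ν j)) (inj₁ lt))

-- Go to the end of row `r`, then to the bottom of the column reached.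
inner-beyond : ∀ μ {r c} → c < row μ r → ∃[ p ] (InnerCorner μ p × r ≤ proj₁ p × c ≤ proj₂ p)
inner-beyond μ {r} {c} c<row with row μ r in row≡
... | suc c' with col μ c' in col≡ | to (row-col μ r c') (≤-reflexive (sym row≡))
...   | suc r' | s≤s r≤r' = (r' , c') , (row'≡ , col≡) , r≤r' , s≤s⁻¹ c<row
  where
  row'≡ : row μ r' ≡ suc c'
  row'≡ = ≤-antisym (≤-trans (conjugate-antitone (row-col μ) r≤r') (≤-reflexive row≡))
                    (from (row-col μ r' c') (≤-reflexive (sym col≡)))

-- Words

module Words (_≺_ : Position → Position → Set)
         (≺-irrefl : ∀ {p} → ¬ p ≺ p)
         (≺-trans : ∀ {p q r} → p ≺ q → q ≺ r → p ≺ r) where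

  Sorted : Word → Set
  Sorted = AllPairs (_≺_ on proj₂)

  ⇝-⊆ : ∀ {w w'} → w ⇝ w' → ∀ {x} → x ∈ w' → x ∈ w
  ⇝-⊆ (cancel u p q v) = [ ∈-++⁺ˡ , ∈-++⁺ʳ u ∘ there ∘ there ]′ ∘ ∈-++⁻ u

  ⇝*-⊆ : ∀ {w w'} → Star _⇝_ w w' → ∀ {x} → x ∈ w' → x ∈ w
  ⇝*-⊆ ε       = id
  ⇝*-⊆ (s ◅ t) = ⇝-⊆ s ∘ ⇝*-⊆ t

  sorted-++ : ∀ u {v} → Sorted (u ++ v) →
    ∀ {x y} → x ∈ u → y ∈ v → proj₂ x ≺ proj₂ y
  sorted-++ (_ ∷ u) (lt ∷ _) (here refl) y∈v = All.lookup lt (∈-++⁺ʳ u y∈v)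
  sorted-++ (_ ∷ u) (_ ∷ so) (there x∈u) y∈v = sorted-++ u so x∈u y∈v

  sorted-tail : ∀ u {v} → Sorted (u ++ v) → Sorted v
  sorted-tail []      so       = so
  sorted-tail (_ ∷ u) (_ ∷ so) = sorted-tail u so

  sorted-cancel : ∀ {w w'} → w ⇝ w' → Sorted w → Sorted w'
  sorted-cancel (cancel []      p q v) (_ ∷ _ ∷ so) = so
  sorted-cancel (cancel (x ∷ u) p q v) (lt ∷ so)    =
    All.tabulate (λ y∈ → All.lookup lt (⇝-⊆ (cancel u p q v) y∈)) ∷ sorted-cancel (cancel u p q v) so

  -- In the final word `x` carries the last +, so a + at a later `y` is cancelled at some step. The
  -- - cancelled with it is then adjacent to it, while `x` is still present, so this - lies between
  -- the two.
  matched-after : ∀ {w P x M} → Sorted w →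
    Star _⇝_ w (P ++ (Sign.+ , x) ∷ M) → All (λ e → proj₁ e ≡ Sign.-) M →
    ∀ {y} → (Sign.+ , y) ∈ w → x ≺ y → ∃[ m ] ((Sign.- , m) ∈ w × x ≺ m × m ≺ y)
  matched-after {P = P} so ε minus y∈w x≺y with ∈-++⁻ P y∈w
  ... | inj₁ y∈P          = contradiction (≺-trans x≺y (sorted-++ P so y∈P (here refl))) ≺-irrefl
  ... | inj₂ (here refl)  = contradiction x≺y ≺-irrefl
  ... | inj₂ (there y∈M)  = contradiction (All.lookup minus y∈M) λ ()
  matched-after {P = P} {x} {M} so (s@(cancel u p q v) ◅ t) minus {y} y∈w x≺y = by (∈-++⁻ u y∈w)
    where
    survives : (Sign.+ , x) ∈ u ++ v
    survives = ⇝*-⊆ t (∈-++⁺ʳ P (here refl))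

    recurse : (Sign.+ , y) ∈ u ++ v →
      ∃[ m ] ((Sign.- , m) ∈ u ++ (Sign.- , p) ∷ (Sign.+ , q) ∷ v × x ≺ m × m ≺ y)
    recurse y∈ = let m , m∈ , lt = matched-after (sorted-cancel s so) t minus y∈ x≺y
                 in m , ⇝-⊆ s m∈ , lt

    by : (Sign.+ , y) ∈ u ⊎ (Sign.+ , y) ∈ (Sign.- , p) ∷ (Sign.+ , q) ∷ v →
      ∃[ m ] ((Sign.- , m) ∈ u ++ (Sign.- , p) ∷ (Sign.+ , q) ∷ v × x ≺ m × m ≺ y)
    by (inj₁ y∈u)                 = recurse (∈-++⁺ˡ y∈u)
    by (inj₂ (there (there y∈v))) = recurse (∈-++⁺ʳ u y∈v)
    -- Here `y` is the + being cancelled. Everything in `v` comes after it, so `x` survives in `u`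
    -- and therefore precedes `p`.
    by (inj₂ (there (here refl))) with sorted-tail u so | ∈-++⁻ u survives
    ... | (p≺q ∷ _) ∷ _   | inj₁ x∈u = p , ∈-++⁺ʳ u (here refl) , sorted-++ u so x∈u (here refl) , p≺q
    ... | _ ∷ (q≺v ∷ _)   | inj₂ x∈v = contradiction (≺-trans x≺y (All.lookup q≺v x∈v)) ≺-irrefl

  -- A word in which every - gets cancelled. `reduces` carries an arbitrary suffix so that the
  -- reduction can be carried out inside a longer word; `partner` keeps of the bracketing only that
  -- each - has a later + within `u`.
  record Matched (u : Word) : Set where
    field
      pluses  : Word
      allPlus : All (λ e → proj₁ e ≡ Sign.+) pluses
      ⊆u      : ∀ {e} → e ∈ pluses → e ∈ u
      reduces : ∀ z → Star _⇝_ (u ++ z) (pluses ++ z)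
      partner : ∀ {m} → (Sign.- , m) ∈ u → ∃[ y ] ((Sign.+ , y) ∈ u × m ≺ y)

  -- `x` carries the leftmost surviving -. With its sign flipped, the word reduces to pluses, then
  -- the + at `x`, then `minuses`: the shape that `F̂` requires.
  record LeftmostMinus (w : Word) : Set where
    field
      before      : Word
      x           : Position
      after       : Word
      split       : w ≡ before ++ (Sign.- , x) ∷ after
      matched     : Matched before
      minuses     : Word
      allMinus    : All (λ e → proj₁ e ≡ Sign.-) minuses
      afterReduce : Star _⇝_ after minuses

  cons-⇝* : ∀ e {w w'} → Star _⇝_ w w' → Star _⇝_ (e ∷ w) (e ∷ w')
  cons-⇝* e ε                      = ε
  cons-⇝* e (cancel u p q v ◅ t) = cancel (e ∷ u) p q v ◅ cons-⇝* e t

  matched-[] : Matched []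
  matched-[] = record
    { pluses = [] ; allPlus = [] ; ⊆u = λ () ; reduces = λ _ → ε ; partner = λ () }

  matched-plus : ∀ {u} p → Matched u → Matched ((Sign.+ , p) ∷ u)
  matched-plus p m = record
    { pluses  = (Sign.+ , p) ∷ pluses
    ; allPlus = refl ∷ allPlus
    ; ⊆u      = λ { (here eq) → here eq ; (there e∈) → there (⊆u e∈) }
    ; reduces = λ z → cons-⇝* _ (reduces z)
    ; partner = λ { (there m∈) → let y , y∈ , lt = partner m∈ in y , there y∈ , lt }
    }
    where open Matched m

  -- The first surviving + of the tail, if any, cancels the new −.
  matched-minus : ∀ {u} p → All (λ e → p ≺ proj₂ e) u → (m : Matched u) →
    (∀ z → Star _⇝_ (u ++ z) z) ⊎ Matched ((Sign.- , p) ∷ u)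
  matched-minus p lt m with Matched.pluses m | Matched.allPlus m | Matched.⊆u m | Matched.reduces m
  ... | []     | _            | _  | reduces = inj₁ reduces
  matched-minus p lt m | (Sign.+ , q) ∷ Q | refl ∷ allPlus | ⊆u | reduces = inj₂ record
    { pluses  = Q
    ; allPlus = allPlus
    ; ⊆u      = there ∘ ⊆u ∘ there
    ; reduces = λ z → cons-⇝* _ (reduces z) ◅◅ (cancel [] p q (Q ++ z) ◅ ε)
    ; partner = λ
      { (here refl) → q , there (⊆u (here refl)) , All.lookup lt (⊆u (here refl))
      ; (there m∈)  → let y , y∈ , m≺y = Matched.partner m m∈ in y , there y∈ , m≺y }
    }

  -- Letters are prepended one at a time. A new + joins the surviving pluses; a new - either cancels
  -- with the first of them or, if there are none, becomes the leftmost survivor.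
  leftmost-minus : ∀ w → Sorted w → Matched w ⊎ LeftmostMinus w
  leftmost-minus [] _ = inj₁ matched-[]
  leftmost-minus ((Sign.+ , p) ∷ w) (_ ∷ so) with leftmost-minus w so
  ... | inj₁ m = inj₁ (matched-plus p m)
  ... | inj₂ l = inj₂ record
    { LeftmostMinus l using (x; after; minuses; allMinus; afterReduce)
    ; before = (Sign.+ , p) ∷ before ; split = cong (_ ∷_) split ; matched = matched-plus p matched }
    where open LeftmostMinus l
  leftmost-minus ((Sign.- , p) ∷ w) (lt ∷ so) with leftmost-minus w so
  ... | inj₁ m with matched-minus p lt m
  ...   | inj₂ m'   = inj₁ m'
  ...   | inj₁ gone = inj₂ record
    { split = refl ; matched = matched-[] ; allMinus = []
    ; afterReduce = subst (λ w' → Star _⇝_ w' []) (++-identityʳ w) (gone [])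
    }
  leftmost-minus ((Sign.- , p) ∷ .(u ++ (Sign.- , x) ∷ v)) (lt ∷ _) | inj₂ record
    { before = u ; x = x ; after = v ; split = refl ; matched = matched
    ; minuses = M ; allMinus = allMinus ; afterReduce = reduces }
    with matched-minus p (All.++⁻ˡ u lt) matched
  ... | inj₂ m'   = inj₂ record
    { split = refl ; matched = m' ; allMinus = allMinus ; afterReduce = reduces }
  -- No + of `u` is left for the new -, so it takes over as leftmost survivor and the former one
  -- joins the minuses.
  ... | inj₁ gone = inj₂ record
    { split = refl ; matched = matched-[] ; allMinus = refl ∷ allMinus
    ; afterReduce = gone ((Sign.- , x) ∷ v) ◅◅ cons-⇝* _ reduces }

-- Ladders, residues and the reading order

ladder-difference : ∀ k a b c d →
  k ℤ.* (b ℤ.- d) ℤ.- (c ℤ.- a) ≡ (a ℤ.+ k ℤ.* b) ℤ.- (c ℤ.+ k ℤ.* d)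
ladder-difference = ℤ.solve-∀

module Ladders (k : ℕ) where

  open LadderCrystal (suc k)

  pos-ladder : ∀ r c → pos (r + k * c) ≡ pos r ℤ.+ pos k ℤ.* pos c
  pos-ladder r c = trans (ℤ.pos-+ r (k * c)) (cong (λ z → pos r ℤ.+ z) (ℤ.pos-* k c))

  sameLadder⇔ : ∀ p q → SameLadder p q ⇔ ladderValue p ≡ ladderValue q
  sameLadder⇔ (a , b) (c , d) = mk⇔
    (λ same → ℤ.+-injective (ℤ.i-j≡0⇒i≡j _ _ (trans (sym difference) (ℤ.i≡j⇒i-j≡0 (sym same)))))
    (λ eq → sym (ℤ.i-j≡0⇒i≡j _ _ (trans difference (ℤ.i≡j⇒i-j≡0 (cong pos eq)))))
    where
    -- For `ℓ = suc k` the factor `ℓ - 1` of `SameLadder` computes to `pos k`, so the two sides of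
    -- its equation differ exactly by the difference of the ladder values.
    difference : pos k ℤ.* (pos b ℤ.- pos d) ℤ.- (pos c ℤ.- pos a) ≡ pos (a + k * b) ℤ.- pos (c + k * d)
    difference = trans (ladder-difference (pos k) (pos a) (pos b) (pos c) (pos d))
      (sym (cong₂ ℤ._-_ (pos-ladder a b) (pos-ladder c d)))

  -- Modulo `suc k` the factor `k` is `-1`, so the ladder value is congruent to `r - c`, the
  -- negative of the residue.
  ∣ladder+residue : ∀ p → suc k ∣ ladderValue p + residue p
  ∣ladder+residue p@(r , c) = ℤ.∣⇒∣ᵤ {pos (suc k)} {pos (r + k * c + n)} (ℤ.divides (pos c ℤ.- q) (begin
    pos (r + k * c + n)                      ≡⟨ ℤ.pos-+ (r + k * c) n ⟩
    pos (r + k * c) ℤ.+ pos n                ≡⟨ cong (ℤ._+ pos n) (pos-ladder r c) ⟩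
    L ℤ.+ pos n                              ≡⟨ regroup L (pos n) y ⟩
    ((pos n ℤ.+ y) ℤ.- y) ℤ.+ L              ≡⟨ cong (λ z → (z ℤ.- y) ℤ.+ L)
                                                  (a≡a%ℕn+[a/ℕn]*n (pos c ℤ.- pos r) (suc k)) ⟨
    ((pos c ℤ.- pos r) ℤ.- y) ℤ.+ L          ≡⟨ collect (pos r) (pos c) q (pos k) ⟩
    (pos c ℤ.- q) ℤ.* pos (suc k)            ∎))
    where
    open ≡-Reasoning
    n = residue p
    q = (pos c ℤ.- pos r) /ℕ suc k
    L = pos r ℤ.+ pos k ℤ.* pos c
    y = q ℤ.* pos (suc k)
    regroup : ∀ x n y → x ℤ.+ n ≡ ((n ℤ.+ y) ℤ.- y) ℤ.+ x
    regroup = ℤ.solve-∀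
    collect : ∀ r c q k → ((c ℤ.- r) ℤ.- q ℤ.* (1ℤ ℤ.+ k)) ℤ.+ (r ℤ.+ k ℤ.* c) ≡ (c ℤ.- q) ℤ.* (1ℤ ℤ.+ k)
    collect = ℤ.solve-∀

  residue<ℓ : ∀ p → residue p < suc k
  residue<ℓ (r , c) = n%ℕd<d (pos c ℤ.- pos r) (suc k)

  -- By `∣ladder+residue`, ladder values of equal residue are congruent modulo `suc k`, so a
  -- positive difference is at least `suc k`.
  residue-gap : ∀ p q → residue p ≡ residue q → ladderValue p < ladderValue q →
    ladderValue p + suc k ≤ ladderValue q
  residue-gap p q res lt with m≤n⇒∃[o]m+o≡n lt
  ... | d , eq = subst (ladderValue p + suc k ≤_) (trans (+-suc _ d) eq)
    (+-monoʳ-≤ (ladderValue p) (∣⇒≤ (∣m+n∣m⇒∣n multiple (∣ladder+residue p))))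
    where
    shift : ∀ a d n → suc a + d + n ≡ (a + n) + suc d
    shift = solve-∀
    multiple : suc k ∣ (ladderValue p + residue p) + suc d
    multiple = subst (suc k ∣_)
      (trans (cong₂ _+_ (sym eq) (sym res)) (shift (ladderValue p) d (residue p))) (∣ladder+residue q)

  unique-remainder : ∀ {a m n} → m < suc k → n < suc k → suc k ∣ a + m → suc k ∣ a + n → m ≡ n
  unique-remainder {a} {m} {n} m< n< dm dn =
    [ (λ m≤n → le m≤n n< dm dn) , (λ n≤m → sym (le n≤m m< dn dm)) ]′ (≤-total m n)
    where
    le : ∀ {m n} → m ≤ n → n < suc k → suc k ∣ a + m → suc k ∣ a + n → m ≡ n
    le {m} m≤n n< dm dn with m≤n⇒∃[o]m+o≡n m≤n
    ... | zero  , refl = sym (+-identityʳ m)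
    ... | suc d , refl = contradiction
      (∣⇒≤ (∣m+n∣m⇒∣n (subst (suc k ∣_) (sym (+-assoc a m (suc d))) dn) dm))
      (<⇒≱ (≤-<-trans (m≤n+m (suc d) m) n<))

  residue-≡ : ∀ p q {e} → suc k ∣ e → ladderValue q ≡ ladderValue p + e → residue p ≡ residue q
  residue-≡ p q {e} ∣e eq = unique-remainder (residue<ℓ p) (residue<ℓ q) (∣ladder+residue p)
    (∣m+n∣m⇒∣n (subst (suc k ∣_)
      (trans (cong (_+ residue q) eq) (swap (ladderValue p) e (residue q))) (∣ladder+residue q)) ∣e)
    where
    swap : ∀ a e n → (a + e) + n ≡ e + (a + n)
    swap = solve-∀

  infix 4 _≺_

  _≺_ : Position → Position → Set
  p ≺ q = ladderValue p < ladderValue q ⊎ (ladderValue p ≡ ladderValue q × proj₁ p < proj₁ q)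

  readBefore⇔≺ : ∀ p q → ReadBefore p q ⇔ p ≺ q
  readBefore⇔≺ p q = mk⇔ (Sum.map₂ λ (same , lt) → to (sameLadder⇔ p q) same , lt)
                          (Sum.map₂ λ (eq , lt) → from (sameLadder⇔ p q) eq , lt)

  ≺-irrefl : ∀ {p} → ¬ p ≺ p
  ≺-irrefl = [ <-irrefl refl , <-irrefl refl ∘ proj₂ ]′

  ≺-trans : ∀ {p q r} → p ≺ q → q ≺ r → p ≺ r
  ≺-trans (inj₁ a)       (inj₁ b)       = inj₁ (<-trans a b)
  ≺-trans (inj₁ a)       (inj₂ (b , _)) = inj₁ (<-≤-trans a (≤-reflexive b))
  ≺-trans (inj₂ (a , _)) (inj₁ b)       = inj₁ (≤-<-trans (≤-reflexive a) b)
  ≺-trans (inj₂ (a , x)) (inj₂ (b , y)) = inj₂ (trans a b , <-trans x y)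

  between-same-ladder : ∀ {p m q} → ladderValue p ≡ ladderValue q → p ≺ m → m ≺ q →
    ladderValue m ≡ ladderValue q × proj₁ p < proj₁ m × proj₁ m < proj₁ q
  between-same-ladder eq (inj₁ p<m)        (inj₁ m<q)        = contradiction (<-trans p<m m<q) (<-irrefl eq)
  between-same-ladder eq (inj₁ p<m)        (inj₂ (m≡q , _))  = contradiction (trans eq (sym m≡q)) (<⇒≢ p<m)
  between-same-ladder eq (inj₂ (p≡m , _))  (inj₁ m<q)        = contradiction (trans (sym p≡m) eq) (<⇒≢ m<q)
  between-same-ladder eq (inj₂ (_ , p<m))  (inj₂ (m≡q , m<q)) = m≡q , p<m , m<q

  -- By `residue-gap` no ladder of this residue lies strictly between those of `p` and `q`.
  between-next-ladder : ∀ {p m q} → residue p ≡ residue m → ladderValue q ≡ ladderValue p + suc k →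
    p ≺ m → m ≺ q →
    (ladderValue m ≡ ladderValue p × proj₁ p < proj₁ m) ⊎ (ladderValue m ≡ ladderValue q × proj₁ m < proj₁ q)
  between-next-ladder         res eq (inj₂ (p≡m , lt)) _          = inj₁ (sym p≡m , lt)
  between-next-ladder         res eq (inj₁ _)          (inj₂ m≺q) = inj₂ m≺q
  between-next-ladder {p} {m} res eq (inj₁ p<m)        (inj₁ m<q) = contradiction
    (≤-trans (≤-reflexive eq) (residue-gap p m res p<m)) (<⇒≱ m<q)

-- Hooks with h = ℓ · arm

module BadHooks (k : ℕ) where

  open LadderCrystal (suc k)
  open Ladders k

  -- The box is (r , c) and its arm is a; its hook condition leg + 1 = (ℓ - 1) · arm
  -- says that column c ends just above row r + k * a.
  BadHook : Partition → Set
  BadHook μ = ∃[ r ] ∃[ c ] ∃[ a ] (row μ r ≡ suc (c + a) × col μ c ≡ r + k * a)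

  badHook⇔ : ∀ μ → (∃[ p ] (p ∈ᵇ μ × hook μ p ≡ suc k * arm μ p)) ⇔ BadHook μ
  badHook⇔ μ = mk⇔ fwd bwd
    where
    open ≡-Reasoning

    fwd : ∃[ p ] (p ∈ᵇ μ × hook μ p ≡ suc k * arm μ p) → BadHook μ
    fwd ((r , c) , c<row , eq) = r , c , a , sym (m+[n∸m]≡n c<row) , (begin
      col μ c                    ≡⟨ m+[n∸m]≡n (to (row-col μ r c) c<row) ⟨
      suc r + (col μ c ∸ suc r)  ≡⟨ +-suc r _ ⟨
      r + suc (col μ c ∸ suc r)  ≡⟨ cong (r +_) (+-comm 1 (col μ c ∸ suc r)) ⟩
      r + (col μ c ∸ suc r + 1)  ≡⟨ cong (r +_) (+-cancelˡ-≡ a _ _ (trans (sym (+-assoc a _ 1))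
                                      (subst (λ l → a + l + 1 ≡ suc k * a) (leg≡ μ r c) eq))) ⟩
      r + k * a                  ∎)
      where
      a : ℕ
      a = arm μ (r , c)

    bwd : BadHook μ → ∃[ p ] (p ∈ᵇ μ × hook μ p ≡ suc k * arm μ p)
    bwd (r , c , a , row≡ , col≡) = (r , c) , c<row , (begin
      arm μ (r , c) + leg μ (r , c) + 1  ≡⟨ cong₂ (λ x y → x + y + 1) arm≡ (leg≡ μ r c) ⟩
      a + (col μ c ∸ suc r) + 1          ≡⟨ +-assoc a _ 1 ⟩
      a + (col μ c ∸ suc r + 1)          ≡⟨ cong (a +_) (+-cancelˡ-≡ r _ _ (begin
        r + (col μ c ∸ suc r + 1)  ≡⟨ cong (r +_) (+-comm (col μ c ∸ suc r) 1) ⟩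
        r + suc (col μ c ∸ suc r)  ≡⟨ +-suc r _ ⟩
        suc r + (col μ c ∸ suc r)  ≡⟨ m+[n∸m]≡n (to (row-col μ r c) c<row) ⟩
        col μ c                    ≡⟨ col≡ ⟩
        r + k * a                  ∎)) ⟩
      a + k * a                          ≡⟨ cong (suc k *_) arm≡ ⟨
      suc k * arm μ (r , c)              ∎)
      where
      c<row : c < row μ r
      c<row = subst (c <_) (sym row≡) (s≤s (m≤m+n c a))
      arm≡ : arm μ (r , c) ≡ a
      arm≡ = trans (cong (_∸ suc c) row≡) (m+n∸m≡n c a)

  -- The box in the row of `m` and the column of `y` has its hand at `m` and its foot just above
  -- `y`. Equal ladder values say that `r' - r` is `k` times the arm `c - d`; they also force
  -- `d ≤ c`, since `y` is lower.
  same-ladder-bad : ∀ μ {m y} → InnerCorner μ m → OuterCorner μ y →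
    ladderValue m ≡ ladderValue y → proj₁ m < proj₁ y → BadHook μ
  same-ladder-bad μ {r , c} {r' , d} (row≡ , _) (_ , col≡) eq r<r'
    with m≤n⇒∃[o]m+o≡n {d} {c} (≮⇒≥ λ c<d → <-irrefl eq (+-mono-<-≤ r<r' (*-monoʳ-≤ k (<⇒≤ c<d))))
  ... | a , refl = r , d , a , row≡ , trans col≡ (+-cancelʳ-≡ (k * d) _ _ (trans (sym eq) (shift k r d a)))
    where
    shift : ∀ k r d a → r + k * (d + a) ≡ r + k * a + k * d
    shift = solve-∀

  -- The box in the row of `y` and the column of `m` has its foot at `m` and its hand just left of
  -- `y`. The shift by `suc k` accounts for these two off-by-ones: `k` for the column and `1` for
  -- the row.
  next-ladder-bad : ∀ μ {m y} → InnerCorner μ m → OuterCorner μ y →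
    ladderValue y ≡ ladderValue m + suc k → proj₁ y ≤ proj₁ m → BadHook μ
  next-ladder-bad μ {r , c} {r' , d} (_ , col≡) (row≡ , _) eq r'≤r
    with m≤n⇒∃[o]m+o≡n {suc c} {d} (≰⇒> λ d≤c → m+1+n≰m _
           (≤-trans (≤-reflexive (sym eq)) (+-mono-≤ r'≤r (*-monoʳ-≤ k d≤c))))
  ... | a , refl = r' , c , a , row≡ , trans col≡
    (+-cancelʳ-≡ (k * c + k) _ _ (trans (sym (shiftˡ k r c)) (trans (sym eq) (shiftʳ k r' c a))))
    where
    shiftˡ : ∀ k r c → r + k * c + suc k ≡ suc r + (k * c + k)
    shiftˡ = solve-∀
    shiftʳ : ∀ k r c a → r + k * (suc c + a) ≡ r + k * a + (k * c + k)
    shiftʳ = solve-∀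

  module _ μ ν {x} (add : AddBox μ x ν) where

    private
      r = proj₁ x
      c = proj₂ x

      μ-outer = add-outer μ ν add
      ν-inner = add-inner μ ν add

    -- Hooks away from the row and column of `x` persist. For the others, the ladder arithmetic
    -- places a position `y` at the end of the hook after `x`, with the same residue. If `y` is
    -- addable, `matched` supplies a removable box that spans a bad hook with it; if not, the hook
    -- moves by one row or column and is already bad in `μ`.
    add-reflects-bad :
      (∀ y → OuterCorner μ y → residue x ≡ residue y → x ≺ y →
         ∃[ m ] (InnerCorner μ m × residue x ≡ residue m × x ≺ m × m ≺ y)) →
      BadHook ν → BadHook μ
    add-reflects-bad matched (r₀ , c₀ , a , row≡ , col≡) with r₀ ≟ r | c₀ ≟ c
    ... | no r₀≢r  | no c₀≢c  = r₀ , c₀ , a , trans (sym (add-row μ ν add r₀≢r)) row≡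
                                            , trans (sym (add-col μ ν add c₀≢c)) col≡
    -- At `x` itself the arm in `ν` is zero, so a bad hook would give column `c` height `r` instead
    -- of `suc r`.
    ... | yes refl | yes refl = contradiction
      (trans (sym (proj₂ ν-inner)) (trans col≡ (cong (λ a → r + k * a) a≡0)))
      (λ eq → 1+n≢n (trans eq (trans (cong (λ z → r + z) (*-zeroʳ k)) (+-identityʳ r))))
      where
      a≡0 : a ≡ 0
      a≡0 = +-cancelˡ-≡ c a 0 (trans (suc-injective (trans (sym row≡) (proj₁ ν-inner))) (sym (+-identityʳ c)))
    -- The hook lies in the row of x: the position y just below its foot is on the ladder of x.
    ... | yes refl | no c₀≢c  = [ outer , repeated ]′ (outer-or-repeated (row-col μ) c₀)
      where
      c≡ : c ≡ c₀ + a
      c≡ = suc-injective (trans (sym (proj₁ ν-inner)) row≡)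
      colμ≡ : col μ c₀ ≡ r + k * a
      colμ≡ = trans (sym (add-col μ ν add c₀≢c)) col≡
      y : Position
      y = col μ c₀ , c₀
      r<y : r < col μ c₀
      r<y = subst (r <_) (add-col μ ν add c₀≢c)
        (to (row-col ν r c₀) (subst (c₀ <_) (sym row≡) (s≤s (m≤m+n c₀ a))))
      shift : ∀ k r d a → r + k * (d + a) ≡ r + k * a + k * d
      shift = solve-∀
      same : ladderValue x ≡ ladderValue y
      same = trans (cong (λ c → r + k * c) c≡) (trans (shift k r c₀ a) (cong (_+ k * c₀) (sym colμ≡)))
      outer : row μ (col μ c₀) ≡ c₀ → BadHook μ
      outer eq =
        let x≺y = inj₂ (same , r<y)
            m , inner , _ , x≺m , m≺y = matched y (eq , refl)
              (residue-≡ x y (_∣0 _) (trans (sym same) (sym (+-identityʳ _)))) x≺y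
            m≡y , _ , m<y = between-same-ladder same x≺m m≺y
        in same-ladder-bad μ inner (eq , refl) m≡y m<y
      -- Row `r` is one box shorter in `μ`; moving the hook one column to the left restores its arm.
      repeated : ∃[ b ] c₀ ≡ suc b × col μ b ≡ col μ c₀ → BadHook μ
      repeated (b , refl , eq) = r , b , a , trans (proj₁ μ-outer) c≡ , trans eq colμ≡
    -- The hook lies in the column of x: the position y just right of its hand is on the next
    -- ladder of the residue of x.
    ... | no r₀≢r  | yes refl = [ outer , repeated ]′ (outer-or-repeated (col-row μ) r₀)
      where
      rowμ≡ : row μ r₀ ≡ suc (c + a)
      rowμ≡ = trans (sym (add-row μ ν add r₀≢r)) row≡
      sr≡ : suc r ≡ r₀ + k * a
      sr≡ = trans (sym (proj₂ ν-inner)) col≡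
      y : Position
      y = r₀ , row μ r₀
      shift : ∀ k r c a → r + k * suc (c + a) ≡ (r + k * a) + k * c + k
      shift = solve-∀
      shift′ : ∀ k r c → suc r + k * c + k ≡ r + k * c + suc k
      shift′ = solve-∀
      next : ladderValue y ≡ ladderValue x + suc k
      next = trans (cong (λ d → r₀ + k * d) rowμ≡) (trans (shift k r₀ c a)
        (trans (cong (λ s → s + k * c + k) (sym sr≡)) (shift′ k r c)))
      outer : col μ (row μ r₀) ≡ r₀ → BadHook μ
      outer eq =
        let m , inner , res , x≺m , m≺y = matched y (refl , eq)
              (residue-≡ x y ∣-refl next) (inj₁ (subst (ladderValue x <_) (sym next) (m<m+n _ z<s)))
        in [ (λ (m≡x , r<m) → next-ladder-bad μ inner (refl , eq)
                 (trans next (cong (_+ suc k) (sym m≡x)))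
                 (≤-trans (≤-trans (m≤m+n r₀ (k * a)) (≤-reflexive (sym sr≡))) r<m))
           , (λ (m≡y , m<y) → same-ladder-bad μ inner (refl , eq) m≡y m<y) ]′
           (between-next-ladder res next x≺m m≺y)
      -- Column `c` is one box shorter in `μ`; moving the hook one row up compensates for this.
      repeated : ∃[ b ] r₀ ≡ suc b × row μ b ≡ row μ r₀ → BadHook μ
      repeated (b , refl , eq) = b , c , a , trans eq rowμ≡ , trans (proj₂ μ-outer) (suc-injective sr≡)

    -- Dual to `add-reflects-bad`: the end `m` of the hook is read before `x`. If `m` is removable
    -- in `ν`, it spans a bad hook with the addable position from `matched`; if not, the hook moves
    -- one column right or one row down.
    remove-reflects-bad :
      (∀ m → InnerCorner ν m → residue m ≡ residue x → m ≺ x →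
         ∃[ y ] (OuterCorner ν y × residue m ≡ residue y × m ≺ y × y ≺ x)) →
      BadHook μ → BadHook ν
    remove-reflects-bad matched (r₀ , c₀ , a , row≡ , col≡) with r₀ ≟ r | c₀ ≟ c
    ... | no r₀≢r  | no c₀≢c  = r₀ , c₀ , a , trans (add-row μ ν add r₀≢r) row≡
                                            , trans (add-col μ ν add c₀≢c) col≡
    ... | yes refl | yes refl = contradiction
      (trans (sym (proj₁ μ-outer)) row≡) (m≢1+m+n c)
    -- The hook lies in the row of x: its foot m is on the previous ladder of the residue of x.
    ... | yes refl | no c₀≢c  = foot (r + k * a) refl
      where
      c≡ : c ≡ suc (c₀ + a)
      c≡ = trans (sym (proj₁ μ-outer)) row≡
      colν≡ : col ν c₀ ≡ r + k * a
      colν≡ = trans (add-col μ ν add c₀≢c) col≡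
      r<foot : r < r + k * a
      r<foot = subst (r <_) colν≡ (to (row-col ν r c₀) (subst (c₀ <_) (sym (proj₁ ν-inner))
        (subst (λ c → c₀ < suc c) (sym c≡) (m≤n⇒m≤1+n (s≤s (m≤m+n c₀ a))))))
      -- The column ends just above row `r + k * a`. Passing this sum as a variable lets it be
      -- matched as `suc n`, with the foot in row `n`.
      foot : ∀ n → n ≡ r + k * a → BadHook ν
      foot zero    eq = contradiction (subst (r <_) (sym eq) r<foot) λ ()
      foot (suc n) eq = [ inner , repeated ]′ (inner-or-repeated (row-col ν) c₀ col≡n)
        where
        col≡n : col ν c₀ ≡ suc n
        col≡n = trans colν≡ (sym eq)
        m : Position
        m = n , c₀
        shift : ∀ k r c a → r + k * suc (c + a) ≡ (r + k * a) + k * c + k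
        shift = solve-∀
        shift′ : ∀ k n c → suc n + k * c + k ≡ n + k * c + suc k
        shift′ = solve-∀
        next : ladderValue x ≡ ladderValue m + suc k
        next = trans (cong (λ d → r + k * d) c≡) (trans (shift k r c₀ a)
          (trans (cong (λ s → s + k * c₀ + k) (sym eq)) (shift′ k n c₀)))
        inner : row ν n ≡ suc c₀ → BadHook ν
        inner row≡n =
          let corner = row≡n , col≡n
              y , outer , res , m≺y , y≺x = matched m corner
                (residue-≡ m x ∣-refl next) (inj₁ (subst (ladderValue m <_) (sym next) (m<m+n _ z<s)))
          in [ (λ (y≡m , n<y) → same-ladder-bad ν corner outer (sym y≡m) n<y)
             , (λ (y≡x , y<x) → next-ladder-bad ν corner outer (trans y≡x next)
                   (s≤s⁻¹ (≤-trans y<x (≤-trans (m≤m+n r (k * a)) (≤-reflexive (sym eq))))))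
             ]′ (between-next-ladder res next m≺y y≺x)
        repeated : col ν (suc c₀) ≡ col ν c₀ → BadHook ν
        repeated eq′ = r , suc c₀ , a , trans (proj₁ ν-inner) (cong suc c≡) , trans eq′ colν≡
    -- The hook lies in the column of x: its hand m is on the ladder of x.
    ... | no r₀≢r  | yes refl = [ inner , repeated ]′ (inner-or-repeated (col-row ν) r₀ rowν≡)
      where
      rowν≡ : row ν r₀ ≡ suc (c + a)
      rowν≡ = trans (add-row μ ν add r₀≢r) row≡
      r≡ : r ≡ r₀ + k * a
      r≡ = trans (sym (proj₂ μ-outer)) col≡
      m : Position
      m = r₀ , c + a
      shift : ∀ k r c a → r + k * a + k * c ≡ r + k * (c + a)
      shift = solve-∀
      same : ladderValue m ≡ ladderValue x
      same = sym (trans (cong (_+ k * c) r≡) (shift k r₀ c a))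
      inner : col ν (c + a) ≡ suc r₀ → BadHook ν
      inner eq =
        let corner = rowν≡ , eq
            y , outer , _ , m≺y , y≺x = matched m corner
              (residue-≡ m x (_∣0 _) (trans (sym same) (sym (+-identityʳ _))))
              (inj₂ (same , ≤∧≢⇒< (subst (r₀ ≤_) (sym r≡) (m≤m+n r₀ (k * a))) r₀≢r))
            y≡x , m<y , _ = between-same-ladder same m≺y y≺x
        in same-ladder-bad ν corner outer (trans same (sym y≡x)) m<y
      repeated : row ν (suc r₀) ≡ row ν r₀ → BadHook ν
      repeated eq = suc r₀ , c , a , trans eq rowν≡ , trans (proj₂ ν-inner) (cong suc r≡)

-- Signatures

module Signatures (k : ℕ) (1≤k : 1 ≤ k) where

  open LadderCrystal (suc k)
  open Ladders k
  open BadHooks k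
  open Words _≺_ ≺-irrefl ≺-trans

  -- Since `k` is positive, a ladder meets each row at most once, so ladder value and row determine
  -- the position.
  ≺-compare : ∀ p q → p ≺ q ⊎ p ≡ q ⊎ q ≺ p
  ≺-compare p@(r , c) q@(r' , c') with <-cmp (ladderValue p) (ladderValue q)
  ... | tri< lt _ _ = inj₁ (inj₁ lt)
  ... | tri> _ _ gt = inj₂ (inj₂ (inj₁ gt))
  ... | tri≈ _ eq _ with <-cmp r r'
  ...   | tri< lt _ _   = inj₁ (inj₂ (eq , lt))
  ...   | tri> _ _ gt   = inj₂ (inj₂ (inj₂ (sym eq , gt)))
  ...   | tri≈ _ refl _ = inj₂ (inj₁ (cong (r ,_)
    (*-cancelˡ-≡ c c' k {{>-nonZero 1≤k}} (+-cancelˡ-≡ r _ _ eq))))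

  insert : ∀ p {qs} → AllPairs _≺_ qs →
    ∃[ qs' ] (AllPairs _≺_ qs' × p ∈ qs' × (∀ {q} → q ∈ qs → q ∈ qs') ×
            (∀ {o} → o ≺ p → All (o ≺_) qs → All (o ≺_) qs'))
  insert p []  = p ∷ [] , [] ∷ [] , here refl , (λ ()) , λ o≺p _ → o≺p ∷ []
  insert p {q ∷ qs} (q≺ ∷ so) with ≺-compare p q
  ... | inj₁ p≺q         = p ∷ q ∷ qs , (p≺q ∷ All.map (≺-trans p≺q) q≺) ∷ q≺ ∷ so , here refl , there , _∷_
  ... | inj₂ (inj₁ refl) = p ∷ qs , q≺ ∷ so , here refl , id , λ _ all → all
  ... | inj₂ (inj₂ q≺p)  =
    let qs' , so' , p∈ , ⊆ , all = insert p so
    in q ∷ qs' , all q≺p q≺ ∷ so' , there p∈ , (λ { (here eq) → here eq ; (there q∈) → there (⊆ q∈) })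
     , λ { o≺p (o≺q ∷ o≺qs) → o≺q ∷ all o≺p o≺qs }

  sort : ∀ ps → ∃[ qs ] (AllPairs _≺_ qs × (∀ {p} → p ∈ ps → p ∈ qs))
  sort []       = [] , [] , λ ()
  sort (p ∷ ps) =
    let qs , so , ps⊆ = sort ps
        qs' , so' , p∈ , qs⊆ , _ = insert p so
    in qs' , so' , λ { (here refl) → p∈ ; (there p'∈) → qs⊆ (ps⊆ p'∈) }

  Corner : Partition → Sign → Position → Set
  Corner μ Sign.+ = OuterCorner μ
  Corner μ Sign.- = InnerCorner μ

  Labelled : Fin (suc k) → Partition → Sign → Position → Set
  Labelled i μ s p = Corner μ s p × residue p ≡ toℕ i

  hasLabel⇔ : ∀ i μ s p → HasLabel i μ s p ⇔ Labelled i μ s p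
  hasLabel⇔ i μ Sign.+ p = mk⇔ (map₁ (to (addable⇔outer μ))) (map₁ (from (addable⇔outer μ)))
  hasLabel⇔ i μ Sign.- p = mk⇔ (map₁ (to (removable⇔inner μ))) (map₁ (from (removable⇔inner μ)))

  outer-not-inner : ∀ μ {p} → OuterCorner μ p → ¬ InnerCorner μ p
  outer-not-inner μ (row≡c , _) (row≡sc , _) = 1+n≢n (trans (sym row≡sc) row≡c)

  labelled? : ∀ i μ s p → Dec (Labelled i μ s p)
  labelled? i μ Sign.+ p@(r , c) = ((row μ r ≟ c) ×-dec (col μ c ≟ r)) ×-dec (residue p ≟ toℕ i)
  labelled? i μ Sign.- p@(r , c) = ((row μ r ≟ suc c) ×-dec (col μ c ≟ suc r)) ×-dec (residue p ≟ toℕ i)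

  label-word : ∀ i μ p → ∃[ w ] (Sorted w × (∀ s q → (s , q) ∈ w ⇔ (q ≡ p × Labelled i μ s q)))
  label-word i μ p with labelled? i μ Sign.+ p | labelled? i μ Sign.- p
  ... | yes l | _ = (Sign.+ , p) ∷ [] , [] ∷ [] , λ
    { Sign.+ q → mk⇔ (λ { (here refl) → refl , l }) (λ { (refl , _) → here refl })
    ; Sign.- q → mk⇔ (λ { (here ()) ; (there ()) })
                     (λ { (refl , l' , _) → contradiction l' (outer-not-inner μ (proj₁ l)) }) }
  ... | no ¬l | yes l = (Sign.- , p) ∷ [] , [] ∷ [] , λ
    { Sign.+ q → mk⇔ (λ { (here ()) ; (there ()) }) (λ { (refl , l') → contradiction l' ¬l })
    ; Sign.- q → mk⇔ (λ { (here refl) → refl , l }) (λ { (refl , _) → here refl }) }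
  ... | no ¬l | no ¬l' = [] , [] , λ
    { Sign.+ q → mk⇔ (λ ()) (λ { (refl , l) → contradiction l ¬l })
    ; Sign.- q → mk⇔ (λ ()) (λ { (refl , l) → contradiction l ¬l' }) }

  labelled-word : ∀ i μ {qs} → AllPairs _≺_ qs →
    ∃[ w ] (Sorted w × (∀ s q → (s , q) ∈ w ⇔ (q ∈ qs × Labelled i μ s q)))
  labelled-word i μ []  = [] , [] , λ s q → mk⇔ (λ ()) (λ ())
  labelled-word i μ {p ∷ ps} (p≺ ∷ so) =
    let w₁ , so₁ , in₁ = label-word i μ p
        w₂ , so₂ , in₂ = labelled-word i μ so
        p≺w₂ = All.tabulate {xs = w₂} (λ e∈ → All.lookup p≺ (proj₁ (to (in₂ _ _) e∈)))
    in w₁ ++ w₂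
     , AllPairs.++⁺ so₁ so₂ (All.tabulate {xs = w₁} λ e∈ →
         subst (λ q → All (λ e → q ≺ proj₂ e) w₂) (sym (proj₁ (to (in₁ _ _) e∈))) p≺w₂)
     , λ s q → mk⇔
         ([ (λ e∈ → let q≡p , l = to (in₁ s q) e∈ in here q≡p , l)
          , (λ e∈ → let q∈ , l = to (in₂ s q) e∈ in there q∈ , l) ]′ ∘ ∈-++⁻ w₁)
         (λ { (here q≡p , l) → ∈-++⁺ˡ (from (in₁ s q) (q≡p , l))
            ; (there q∈ , l) → ∈-++⁺ʳ w₁ (from (in₂ s q) (q∈ , l)) })

  record Signature (i : Fin (suc k)) (μ : Partition) (w : Word) : Set where
    field
      sorted   : Sorted w
      complete : ∀ s p → (s , p) ∈ w ⇔ Labelled i μ s p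

  isSignature⇔ : ∀ i μ w → IsSignature i μ w ⇔ Signature i μ w
  isSignature⇔ i μ w = mk⇔
    (λ sig → let open IsSignature sig in record
      { sorted   = AllPairs.map (to (readBefore⇔≺ _ _)) sorted
      ; complete = λ s p → Equivalence′.trans (complete s p) (hasLabel⇔ i μ s p) })
    (λ sig → let open Signature sig in record
      { sorted   = AllPairs.map (from (readBefore⇔≺ _ _)) sorted
      ; complete = λ s p → Equivalence′.trans (complete s p) (Equivalence′.sym (hasLabel⇔ i μ s p)) })

  signature-exists : ∀ i μ → ∃[ w ] Signature i μ w
  signature-exists i μ =
    let qs , so , box⊆qs = sort box
        w , so' , in-w = labelled-word i μ so
    in w , record { sorted = so' ; complete = λ s p → mk⇔
         (proj₂ ∘ to (in-w s p))
         (λ l → from (in-w s p) (box⊆qs (corner∈box s (proj₁ l)) , l)) }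
    where
    -- Corners have row at most `col μ 0` and column at most `row μ 0`; `upTo` excludes its bound,
    -- whence the `suc`.
    box : List Position
    box = cartesianProduct (upTo (suc (col μ 0))) (upTo (suc (row μ 0)))

    corner∈box : ∀ s {p} → Corner μ s p → p ∈ box
    corner∈box Sign.+ (refl , col≡) = ∈-cartesianProduct⁺
      (∈-upTo⁺ (s≤s (subst (_≤ col μ 0) col≡ (conjugate-antitone (col-row μ) z≤n))))
      (∈-upTo⁺ (s≤s (conjugate-antitone (row-col μ) z≤n)))
    corner∈box Sign.- (row≡ , col≡) = ∈-cartesianProduct⁺
      (∈-upTo⁺ (m≤n⇒m≤1+n (subst (_≤ col μ 0) col≡ (conjugate-antitone (col-row μ) z≤n))))
      (∈-upTo⁺ (m≤n⇒m≤1+n (subst (_≤ row μ 0) row≡ (conjugate-antitone (row-col μ) z≤n))))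

  -- Crystal operators preserve the absence of bad hooks

  Good : Partition → Set
  Good μ = ¬ BadHook μ

  -- The added box carries the last surviving +, so `matched-after` gives exactly the hypothesis of
  -- `add-reflects-bad`.
  F̂-good : ∀ {i μ ν} → F̂ i μ ν → Good μ → Good ν
  F̂-good {i} {μ} {ν} f good = good ∘ add-reflects-bad μ ν addsBox λ y outer res x≺y →
    let m , m∈ , x≺m , m≺y = matched-after sorted cancels allMinus
          (from (complete Sign.+ y) (outer , trans (sym res) x-residue)) x≺y
        inner , m-residue = to (complete Sign.- m) m∈
    in m , inner , trans x-residue (sym m-residue) , x≺m , m≺y
    where
    open F̂ f
    open Signature (to (isSignature⇔ i μ signature) isSignature)
    x-residue : residue box ≡ toℕ i
    x-residue = proj₂ (to (complete Sign.+ box) (⇝*-⊆ cancels (∈-++⁺ʳ pluses (here refl))))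

  inCrystal⇒good : ∀ {μ} → InCrystal μ → Good μ
  inCrystal⇒good empty         (_ , _ , _ , () , _)
  inCrystal⇒good (apply inc f) = F̂-good f (inCrystal⇒good inc)

  -- Signatures under removal of a box

  -- A step to the right raises the ladder value by `k`, which is positive but below the gap `suc k`
  -- that equal residues require. A step down raises it by `1`, again below `suc k`.
  right-residue : ∀ r c → residue (r , c) ≢ residue (r , suc c)
  right-residue r c res = <⇒≱ (n<1+n k) (+-cancelˡ-≤ (r + k * c) _ _
    (≤-trans (residue-gap (r , c) (r , suc c) res (subst (r + k * c <_) (sym step) (m<m+n _ 1≤k)))
             (≤-reflexive step)))
    where
    step : r + k * suc c ≡ r + k * c + k
    step = trans (cong (r +_) (trans (*-suc k c) (+-comm k (k * c)))) (sym (+-assoc r (k * c) k))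

  below-residue : ∀ r c → residue (r , c) ≢ residue (suc r , c)
  below-residue r c res = <⇒≱ (s≤s 1≤k) (+-cancelˡ-≤ (r + k * c) _ _
    (≤-trans (residue-gap (r , c) (suc r , c) res (n<1+n _)) (≤-reflexive (+-comm 1 _))))

  module _ μ ν {x} (add : AddBox μ x ν) where

    private
      r = proj₁ x
      c = proj₂ x

    corner-in-row : ∀ s c' → Corner μ s (r , c') ⊎ Corner ν s (r , c') →
      c' ≡ c ⊎ c ≡ suc c' ⊎ c' ≡ suc c
    corner-in-row Sign.+ c' (inj₁ (eq , _)) = inj₁ (trans (sym eq) (proj₁ (add-outer μ ν add)))
    corner-in-row Sign.- c' (inj₁ (eq , _)) = inj₂ (inj₁ (trans (sym (proj₁ (add-outer μ ν add))) eq))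
    corner-in-row Sign.+ c' (inj₂ (eq , _)) = inj₂ (inj₂ (trans (sym eq) (proj₁ (add-inner μ ν add))))
    corner-in-row Sign.- c' (inj₂ (eq , _)) = inj₁ (suc-injective (trans (sym eq) (proj₁ (add-inner μ ν add))))

    corner-in-col : ∀ s r' → Corner μ s (r' , c) ⊎ Corner ν s (r' , c) →
      r' ≡ r ⊎ r ≡ suc r' ⊎ r' ≡ suc r
    corner-in-col Sign.+ r' (inj₁ (_ , eq)) = inj₁ (trans (sym eq) (proj₂ (add-outer μ ν add)))
    corner-in-col Sign.- r' (inj₁ (_ , eq)) = inj₂ (inj₁ (trans (sym (proj₂ (add-outer μ ν add))) eq))
    corner-in-col Sign.+ r' (inj₂ (_ , eq)) = inj₂ (inj₂ (trans (sym eq) (proj₂ (add-inner μ ν add))))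
    corner-in-col Sign.- r' (inj₂ (_ , eq)) = inj₁ (suc-injective (trans (sym eq) (proj₂ (add-inner μ ν add))))

    -- Lengths change only in the row and column of `x`. A corner of `μ` or `ν` there is `x` itself
    -- or adjacent to it, and adjacent positions have a different residue.
    corner-unchanged : ∀ s p → residue p ≡ residue x → p ≢ x → Corner μ s p ⇔ Corner ν s p
    corner-unchanged s (r' , c') res p≢x with r' ≟ r | c' ≟ c
    corner-unchanged Sign.+ _ res p≢x | no r'≢r | no c'≢c
      rewrite add-row μ ν add r'≢r | add-col μ ν add c'≢c = mk⇔ id id
    corner-unchanged Sign.- _ res p≢x | no r'≢r | no c'≢c
      rewrite add-row μ ν add r'≢r | add-col μ ν add c'≢c = mk⇔ id id
    corner-unchanged s (_ , c') res p≢x | yes refl | _ =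
      mk⇔ (λ l → contradiction (corner-in-row s c' (inj₁ l)) excluded)
          (λ l → contradiction (corner-in-row s c' (inj₂ l)) excluded)
      where
      excluded : ¬ (c' ≡ c ⊎ c ≡ suc c' ⊎ c' ≡ suc c)
      excluded (inj₁ refl)        = p≢x refl
      excluded (inj₂ (inj₁ eq))   = right-residue r c' (trans res (cong (λ d → residue (r , d)) eq))
      excluded (inj₂ (inj₂ refl)) = right-residue r c (sym res)
    corner-unchanged s (r' , _) res p≢x | no _ | yes refl =
      mk⇔ (λ l → contradiction (corner-in-col s r' (inj₁ l)) excluded)
          (λ l → contradiction (corner-in-col s r' (inj₂ l)) excluded)
      where
      excluded : ¬ (r' ≡ r ⊎ r ≡ suc r' ⊎ r' ≡ suc r)
      excluded (inj₁ refl)        = p≢x refl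
      excluded (inj₂ (inj₁ eq))   = below-residue r' c (trans res (cong (λ d → residue (d , c)) eq))
      excluded (inj₂ (inj₂ refl)) = below-residue r c (sym res)

    remove-signature : ∀ {i} u {v} → Signature i ν (u ++ (Sign.- , x) ∷ v) →
      Signature i μ (u ++ (Sign.+ , x) ∷ v)
    remove-signature {i} u {v} sig = record
      -- The order sees positions only, and both words list the same ones.
      { sorted = AllPairs.map⁻ (subst (AllPairs _≺_)
          (trans (map-++ proj₂ u _) (sym (map-++ proj₂ u _))) (AllPairs.map⁺ sorted))
      ; complete = λ s p → mk⇔ (fwd s p) (bwd s p)
      }
      where
      open Signature sig

      x-residue : residue x ≡ toℕ i
      x-residue = proj₂ (to (complete Sign.- x) (∈-++⁺ʳ u (here refl)))

      other : ∀ {s p} → (s , p) ∈ u ++ (Sign.- , x) ∷ v → p ≢ x → Labelled i μ s p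
      other {s} {p} e∈ p≢x = let corner , res = to (complete s p) e∈ in
        from (corner-unchanged s p (trans res (sym x-residue)) p≢x) corner , res

      fwd : ∀ s p → (s , p) ∈ u ++ (Sign.+ , x) ∷ v → Labelled i μ s p
      fwd s p e∈ with ∈-++⁻ u e∈
      ... | inj₁ e∈u         = other (∈-++⁺ˡ e∈u) λ { refl → ≺-irrefl (sorted-++ u sorted e∈u (here refl)) }
      ... | inj₂ (here refl) = add-outer μ ν add , x-residue
      ... | inj₂ (there e∈v) with sorted-tail u sorted
      ...   | x≺v ∷ _        = other (∈-++⁺ʳ u (there e∈v)) λ { refl → ≺-irrefl (All.lookup x≺v e∈v) }

      bwd : ∀ s p → Labelled i μ s p → (s , p) ∈ u ++ (Sign.+ , x) ∷ v
      bwd s p (corner , res) with p ≟ₚ x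
      bwd Sign.+ _ _            | yes refl = ∈-++⁺ʳ u (here refl)
      bwd Sign.- _ (corner , _) | yes refl = contradiction corner (outer-not-inner μ (add-outer μ ν add))
      ... | no p≢x with ∈-++⁻ u (from (complete s p)
                      (to (corner-unchanged s p (trans res (sym x-residue)) p≢x) corner , res))
      ...   | inj₁ e∈u         = ∈-++⁺ˡ e∈u
      ...   | inj₂ (here refl) = contradiction refl p≢x
      ...   | inj₂ (there e∈v) = ∈-++⁺ʳ u (there e∈v)

  -- Descent to the empty partition

  -- The box left of `y` has ladder value smaller by `k`; in column `0` the box above `y` is used,
  -- with value smaller by `1`. Either value still exceeds `n`, and the removable box beyond has at
  -- least that value.
  inner-above : ∀ ν {y n} → OuterCorner ν y → n + suc k ≤ ladderValue y →
    ∃[ m ] (InnerCorner ν m × n < ladderValue m)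
  inner-above ν {a , suc d} {n} (row≡ , _) le =
    let m , inner , a≤ , d≤ = inner-beyond ν (≤-reflexive (sym row≡))
    in m , inner , ≤-trans
         (+-cancelʳ-≤ k (suc n) (a + k * d) (subst₂ _≤_ (+-suc n k) (shift k a d) le))
         (+-mono-≤ a≤ (*-monoʳ-≤ k d≤))
    where
    shift : ∀ k a d → a + k * suc d ≡ a + k * d + k
    shift = solve-∀
  inner-above ν {zero , zero} {n} _ le = contradiction
    (≤-trans (m≤n+m (suc k) n) (≤-trans le (≤-reflexive (*-zeroʳ k)))) λ ()
  inner-above ν {suc a , zero} {n} (_ , col≡) le =
    let m , inner , a≤ , _ = inner-beyond ν (from (row-col ν a 0) (≤-reflexive (sym col≡)))
    in m , inner , ≤-trans n<a (≤-trans a≤ (m≤m+n _ _))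
    where
    n<a : n < a
    n<a = s≤s⁻¹ (≤-trans (s≤s (subst (_≤ n + k) (+-comm n 1) (+-monoʳ-≤ n 1≤k)))
      (subst₂ _≤_ (+-suc n k) (trans (cong (suc a +_) (*-zeroʳ k)) (+-identityʳ (suc a))) le))

  -- Climbing to removable boxes of larger ladder value ends at one with no later + of its residue.
  leftmost-minus-exists : ∀ ν → Good ν → ∀ n {m} → InnerCorner ν m →
    col ν 0 + k * row ν 0 < n + ladderValue m →
    ∃[ i ] ∃[ w ] (Signature i ν w × LeftmostMinus w)
  -- Every removable box has ladder value at most `col ν 0 + k * row ν 0`, so the climb cannot
  -- exhaust `n`.
  leftmost-minus-exists ν good zero {r , c} (row≡ , col≡) lt = contradiction
    (+-mono-≤ (≤-trans (n≤1+n r) (subst (_≤ col ν 0) col≡ (conjugate-antitone (col-row ν) z≤n)))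
      (*-monoʳ-≤ k (≤-trans (n≤1+n c) (subst (_≤ row ν 0) row≡ (conjugate-antitone (row-col ν) z≤n)))))
    (<⇒≱ lt)
  leftmost-minus-exists ν good (suc n) {m} inner lt
    with fromℕ< (residue<ℓ m) | toℕ-fromℕ< (residue<ℓ m)
  ... | i | i≡ with signature-exists i ν
  ... | w , sig with any? (λ e → (proj₁ e ≟ₛ Sign.+) ×-dec (ladderValue m <? ladderValue (proj₂ e))) w
  ... | yes later =
    let (_ , y) , y∈ , s≡ , m<y = find later
        outer , res = to (Signature.complete sig Sign.+ y) (subst (λ s → (s , y) ∈ w) s≡ y∈)
        m' , inner' , m<m' = inner-above ν outer (residue-gap m y (trans (sym i≡) (sym res)) m<y)
    in leftmost-minus-exists ν good n inner'
         (<-≤-trans lt (≤-trans (≤-reflexive (sym (+-suc n _))) (+-monoʳ-≤ n m<m')))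
  ... | no ¬later with leftmost-minus w (Signature.sorted sig)
  ...   | inj₂ l       = i , w , sig , l
  -- A partner of `m` on a later ladder is excluded by `¬later`; one further down its own ladder
  -- would span a bad hook with `m`.
  ...   | inj₁ matched with Matched.partner matched (from (Signature.complete sig Sign.- m) (inner , sym i≡))
  ...     | y , y∈ , inj₁ m<y        = contradiction (lose y∈ (refl , m<y)) ¬later
  ...     | y , y∈ , inj₂ (m≡y , r<) = contradiction
    (same-ladder-bad ν inner (proj₁ (to (Signature.complete sig Sign.+ y) y∈)) m≡y r<) good

  ++-⇝* : ∀ u {w w'} → Star _⇝_ w w' → Star _⇝_ (u ++ w) (u ++ w')
  ++-⇝* []      t = t
  ++-⇝* (e ∷ u) t = cons-⇝* e (++-⇝* u t)

  -- The box of the leftmost surviving - is removed. Its sign becomes +, and the reductions on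
  -- either side of it show that it is the rightmost surviving +.
  F̂-preimage : ∀ ν → Good ν → ∀ {m} → InnerCorner ν m →
    ∃[ i ] ∃[ μ ] (F̂ i μ ν × Good μ × size μ < size ν)
  F̂-preimage ν good {m} inner
    with leftmost-minus-exists ν good (suc (col ν 0 + k * row ν 0)) inner (m≤m+n _ (ladderValue m))
  ... | i , _ , sig , record { before = u ; x = x ; after = v ; split = refl ; matched = matched
                             ; minuses = M ; allMinus = allMinus ; afterReduce = afterReduce } =
    i , μ , record
      { isSignature = from (isSignature⇔ i μ _) (remove-signature μ ν add u sig)
      ; pluses      = pluses
      ; allPlus     = allPlus
      ; allMinus    = allMinus
      ; cancels     = reduces _ ◅◅ ++-⇝* pluses (cons-⇝* _ afterReduce)
      ; addsBox     = add
      } , good ∘ remove-reflects-bad μ ν add partnered , add-size μ ν add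
    where
    open Matched matched
    open Signature sig

    x-labelled : Labelled i ν Sign.- x
    x-labelled = to (complete Sign.- x) (∈-++⁺ʳ u (here refl))

    removable : Removable ν x
    removable = from (removable⇔inner ν) (proj₁ x-labelled)

    μ : Partition
    μ = proj₁ removable

    add : AddBox μ x ν
    add = remove⇒add μ ν (proj₂ removable)

    -- A - read before `x` lies in `u`, where it has a later +; that + precedes `x`.
    partnered : ∀ m → InnerCorner ν m → residue m ≡ residue x → m ≺ x →
      ∃[ y ] (OuterCorner ν y × residue m ≡ residue y × m ≺ y × y ≺ x)
    partnered m inner res m≺x
      with ∈-++⁻ u (from (complete Sign.- m) (inner , trans res (proj₂ x-labelled)))
    ... | inj₂ (here refl) = contradiction m≺x ≺-irrefl
    ... | inj₂ (there m∈v) with sorted-tail u sorted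
    ...   | x≺v ∷ _        = contradiction (≺-trans m≺x (All.lookup x≺v m∈v)) ≺-irrefl
    partnered m inner res m≺x | inj₁ m∈u =
      let y , y∈u , m≺y = partner m∈u
          outer , y-residue = to (complete Sign.+ y) (∈-++⁺ˡ y∈u)
      in y , outer , trans res (trans (proj₂ x-labelled) (sym y-residue)) , m≺y
       , sorted-++ u sorted y∈u (here refl)

  -- Induction on a strict bound `n` for the size. A nonempty partition has a removable box, from
  -- which `F̂-preimage` starts its search.
  good⇒inCrystal : ∀ n ν → size ν < n → Good ν → InCrystal ν
  -- Matching the proof fields too makes the record definitionally `∅`.
  good⇒inCrystal (suc n) record { parts = [] ; decreasing = [] ; positive = [] } _ _ = empty
  good⇒inCrystal (suc n) ν@(record { parts = _ ∷ _ ; positive = 0<x ∷ _ }) size<n good =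
    let _ , inner , _ = inner-beyond ν {0} {0} 0<x
        _ , μ , f , good' , smaller = F̂-preimage ν good inner
    in apply (good⇒inCrystal n μ (<-≤-trans smaller (s≤s⁻¹ size<n)) good') f

theorem3p11p2p3 : (ℓ : ℕ) .{{_ : NonZero ℓ}} → 3 ≤ ℓ → (μ : Partition) →
    LadderCrystal.InCrystal ℓ μ ⇔
    (¬ (∃[ p ] (p ∈ᵇ μ × hook μ p ≡ ℓ * arm μ p)))
theorem3p11p2p3 (suc k) (s≤s 2≤k) μ = mk⇔
  (λ inc → inCrystal⇒good inc ∘ to (badHook⇔ μ))
  (λ none → good⇒inCrystal (suc (size μ)) μ ≤-refl (none ∘ from (badHook⇔ μ)))
  where
  open BadHooks k using (badHook⇔)
  open Signatures k (≤-trans (n≤1+n 1) 2≤k)
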